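{- Let $G$ be a loopless graph. Then the following are equivalent: (a) the closed-neighbourhood-set system $(V(G),\mathcal{N}_{cl}(G))$ is a well-graded family; (b) the closed-neighbourhood-set system $(V(G),\mathcal{N}_{cl}(G))$ is an extremal system; (c) $G$ is either a complete graph or a between-full-union of some co-half-graphs and a complete graph; (d) the neighbourhood-set system $(V(G^c),\mathcal{N}(G^c))$ of the complement $G^c$ is a well-graded family. Moreover, the following are equivalent: $(V(G),\mathcal{N}_{cl}(G))$ is a maximum system; $(V(G^c),\mathcal{N}(G^c))$ is a maximum system; $G$ is a complete graph.
   Context: Graphs are finite, undirected, with nonempty vertex set (in particular complete graphs have at least one vertex) and no multiple edges. $N_G(v)$ is the set of vertices adjacent to $v$, $N_G[v]=N_G(v)\cup\{v\}$, $\mathcal{N}(G)=\{N_G(v):v\in V(G)\}$, $\mathcal{N}_{cl}(G)=\{N_G[v]:v\in V(G)\}$ (sets of subsets of $V(G)$, without multiplicities). For a loopless graph $G$, the complement $G^c$ is the loopless graph on the same vertex set in which two distinct vertices are adjacent iff they are not adjacent in $G$. A co-half-graph of order $n\ge1$ is a graph with vertices $a_1,\dots,a_n,b_1,\dots,b_n$ whose edges are exactly: $a_ia_j$ and $b_ib_j$ for all $i\ne j$, and $a_ib_j$ for all $i>j$. The between-full-union of graphs $G_1$ and $G_2$ is the graph on the disjoint union of $V(G_1)$ and $V(G_2)$ with edge set $E(G_1)\cup E(G_2)\cup\{(v,w):v\in V(G_1),w\in V(G_2)\}$; it is applied iteratively to several graphs. A set system $(X,\mathcal{F})$ is a finite set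 $X$ with a nonempty family $\mathcal{F}$ of distinct subsets of $X$. Its one-inclusion graph has a vertex $v_A$ for each $A\in\mathcal{F}$, with an edge (directed from $v_A$ to $v_B$, labelled $b$) whenever $B=A\cup\{b\}$ for some $b\in X\setminus A$. The system is well-graded if for all $A,B\in\mathcal{F}$ the distance between $v_A$ and $v_B$ in the underlying undirected graph equals $|A\triangle B|$ (infinite distance if there is no path). $Y\subseteq X$ is shattered if $\mathcal{F}\cap Y:=\{A\cap Y:A\in\mathcal{F}\}$ is the full power set of $Y$; the VC-dimension is the largest size of a shattered set. $Y$ is strongly shattered if there is $T\subseteq X\setminus Y$ with $\{Z\cup T:Z\subseteq Y\}\subseteq\mathcal{F}$. The system is extremal if the shattered and strongly shattered sets coincide. The system, with VC-dimension $d$, is maximum if $|\mathcal{F}\cap Y|=\sum_{i=0}^d\binom{|Y|}{i}$ for every $Y\subseteq X$. -}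

module Defs where

import Data.Bool.Properties as Bool
open import Data.Fin using (Fin; _>_; fromℕ<)
open import Data.Fin.Properties using (_≟_; _<?_; any?)
open import Data.Fin.Subset using (Subset; ⁅_⁆; _∪_; _∩_; _─_; ∁; ∣_∣; _⊆_)
  renaming (_∉_ to _∉ˢ_)
open import Data.Fin.Subset.Properties using (_∈?_)
open import Data.List using (List; []; _∷_; length; lookup; map; deduplicate; upTo)
  renaming (tabulate to tabulateᴸ)
open import Data.List.Membership.Propositional using (_∈_)
open import Data.List.Membership.Propositional.Properties using (∈-tabulate⁺; ∈-deduplicate⁺)
open import Data.List.Relation.Unary.All using (All)
open import Data.List.Relation.Unary.Unique.Propositional using (Unique)
import Data.List.Relation.Unary.Unique.DecPropositional.Properties as DecUnique
open import Data.Nat using (ℕ; suc; _≤_; NonZero; >-nonZero⁻¹)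
open import Data.Nat.Combinatorics using (_C_)
open import Data.Nat.ListAction using (sum)
open import Data.Product using (_×_; _,_; ∃; ∃-syntax)
open import Data.Sum using (_⊎_; inj₁; inj₂)
open import Data.Unit using (⊤; tt)
open import Data.Vec using (tabulate)
open import Data.Vec.Properties using (≡-dec)
open import Function.Bundles using (_⇔_; _↔_; Inverse)
open import Relation.Binary.Definitions using (Decidable; DecidableEquality; Symmetric)
open import Relation.Binary.PropositionalEquality using (_≡_; _≢_; refl; sym)
open import Relation.Nullary using (¬_; yes; no; does)
open import Relation.Nullary.Decidable using (_×-dec_; _⊎-dec_; ¬?)

private
  variable
    n : ℕ
    V W : Set

-- Loops are allowed.  The finite graphs with n vertices are those on Fin n;
-- other vertex types are used for the building blocks below.
record Graph (V : Set) : Set₁ where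
  field
    Adj     : V → V → Set
    adj?    : Decidable Adj
    adj-sym : Symmetric Adj

open Graph public

Loopless : Graph V → Set
Loopless G = ∀ v → ¬ Adj G v v

complement : Graph (Fin n) → Graph (Fin n)
complement G .Adj v w = v ≢ w × ¬ Adj G v w
complement G .adj? v w = ¬? (v ≟ w) ×-dec ¬? (adj? G v w)
complement G .adj-sym (v≢w , ¬vw) = (λ w≡v → v≢w (sym w≡v)) , (λ wv → ¬vw (adj-sym G wv))

record _≅_ (G : Graph V) (H : Graph W) : Set where
  field
    bijection : V ↔ W
    preserves : ∀ v w → Adj G v w ⇔ Adj H (Inverse.to bijection v) (Inverse.to bijection w)

completeGraph : ∀ n → Graph (Fin n)
completeGraph n .Adj v w = v ≢ w
completeGraph n .adj? v w = ¬? (v ≟ w)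
completeGraph n .adj-sym v≢w w≡v = v≢w (sym w≡v)

-- inj₁ i is the vertex aᵢ and inj₂ j is the vertex bⱼ.
coHalfGraph : ∀ n → Graph (Fin n ⊎ Fin n)
coHalfGraph n .Adj (inj₁ i) (inj₁ j) = i ≢ j
coHalfGraph n .Adj (inj₂ i) (inj₂ j) = i ≢ j
coHalfGraph n .Adj (inj₁ i) (inj₂ j) = i > j
coHalfGraph n .Adj (inj₂ j) (inj₁ i) = i > j
coHalfGraph n .adj? (inj₁ i) (inj₁ j) = ¬? (i ≟ j)
coHalfGraph n .adj? (inj₂ i) (inj₂ j) = ¬? (i ≟ j)
coHalfGraph n .adj? (inj₁ i) (inj₂ j) = j <? i
coHalfGraph n .adj? (inj₂ j) (inj₁ i) = j <? i
coHalfGraph n .adj-sym {inj₁ i} {inj₁ j} i≢j j≡i = i≢j (sym j≡i)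
coHalfGraph n .adj-sym {inj₂ i} {inj₂ j} i≢j j≡i = i≢j (sym j≡i)
coHalfGraph n .adj-sym {inj₁ i} {inj₂ j} i>j = i>j
coHalfGraph n .adj-sym {inj₂ j} {inj₁ i} i>j = i>j

betweenFullUnion : Graph V → Graph W → Graph (V ⊎ W)
betweenFullUnion G H .Adj (inj₁ v) (inj₁ w) = Adj G v w
betweenFullUnion G H .Adj (inj₂ v) (inj₂ w) = Adj H v w
betweenFullUnion G H .Adj (inj₁ _) (inj₂ _) = ⊤
betweenFullUnion G H .Adj (inj₂ _) (inj₁ _) = ⊤
betweenFullUnion G H .adj? (inj₁ v) (inj₁ w) = adj? G v w
betweenFullUnion G H .adj? (inj₂ v) (inj₂ w) = adj? H v w
betweenFullUnion G H .adj? (inj₁ _) (inj₂ _) = yes tt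
betweenFullUnion G H .adj? (inj₂ _) (inj₁ _) = yes tt
betweenFullUnion G H .adj-sym {inj₁ _} {inj₁ _} vw = adj-sym G vw
betweenFullUnion G H .adj-sym {inj₂ _} {inj₂ _} vw = adj-sym H vw
betweenFullUnion G H .adj-sym {inj₁ _} {inj₂ _} _ = tt
betweenFullUnion G H .adj-sym {inj₂ _} {inj₁ _} _ = tt

UnionVertex : List ℕ → ℕ → Set
UnionVertex []       m = Fin m
UnionVertex (k ∷ ks) m = (Fin k ⊎ Fin k) ⊎ UnionVertex ks m

-- The list ks gives the orders of the co-half-graphs.
coHalfUnion : ∀ ks m → Graph (UnionVertex ks m)
coHalfUnion []       m = completeGraph m
coHalfUnion (k ∷ ks) m = betweenFullUnion (coHalfGraph k) (coHalfUnion ks m)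

IsComplete : Graph V → Set
IsComplete G = ∃[ m ] NonZero m × G ≅ completeGraph m

IsUnionOfCoHalfGraphsAndComplete : Graph V → Set
IsUnionOfCoHalfGraphsAndComplete G =
  ∃[ ks ] ∃[ m ] ks ≢ [] × All NonZero ks × NonZero m × G ≅ coHalfUnion ks m

data Walk (G : Graph V) : V → V → ℕ → Set where
  nil  : ∀ {v} → Walk G v v 0
  cons : ∀ {u v w k} → Adj G u v → Walk G v w k → Walk G u w (suc k)

-- Infinite distance is the case in which no k satisfies Distance G v w k.
Distance : Graph V → V → V → ℕ → Set
Distance G v w k = Walk G v w k × (∀ j → Walk G v w j → k ≤ j)

_≟ˢ_ : DecidableEquality (Subset n)
_≟ˢ_ = ≡-dec Bool._≟_

_△_ : Subset n → Subset n → Subset n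
A △ B = (A ─ B) ∪ (B ─ A)

record SetSystem (n : ℕ) : Set where
  field
    members  : List (Subset n)
    distinct : Unique members
    nonempty : ∃[ A ] A ∈ members

open SetSystem public

-- The family {f v : v ∈ Fin n}, without multiplicities.
rangeSystem : .{{_ : NonZero n}} → (Fin n → Subset n) → SetSystem n
rangeSystem f .members = deduplicate _≟ˢ_ (tabulateᴸ f)
rangeSystem f .distinct = DecUnique.deduplicate-! _≟ˢ_ (tabulateᴸ f)
rangeSystem {n} f .nonempty = f v₀ , ∈-deduplicate⁺ _≟ˢ_ (∈-tabulate⁺ v₀)
  where v₀ = fromℕ< (>-nonZero⁻¹ n)

N : Graph (Fin n) → Fin n → Subset n
N G v = tabulate (λ w → does (adj? G v w))

N[_] : Graph (Fin n) → Fin n → Subset n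
N[ G ] v = N G v ∪ ⁅ v ⁆

nbhdSystem : .{{_ : NonZero n}} → Graph (Fin n) → SetSystem n
nbhdSystem G = rangeSystem (N G)

closedNbhdSystem : .{{_ : NonZero n}} → Graph (Fin n) → SetSystem n
closedNbhdSystem G = rangeSystem N[ G ]

module _ (S : SetSystem n) where

  -- The members are distinct, so their positions in the list serve as the
  -- vertices of the one-inclusion graph.
  OIVertex : Set
  OIVertex = Fin (length (members S))

  ⟦_⟧ : OIVertex → Subset n
  ⟦ i ⟧ = lookup (members S) i

  -- The edge directed from i to j and labelled b.
  Arc : OIVertex → OIVertex → Fin n → Set
  Arc i j b = b ∉ˢ ⟦ i ⟧ × ⟦ j ⟧ ≡ ⟦ i ⟧ ∪ ⁅ b ⁆

  oneInclusionGraph : Graph OIVertex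
  oneInclusionGraph .Adj i j = ∃ (Arc i j) ⊎ ∃ (Arc j i)
  oneInclusionGraph .adj? i j = arc? i j ⊎-dec arc? j i
    where arc? = λ i j → any? (λ b → ¬? (b ∈? ⟦ i ⟧) ×-dec (⟦ j ⟧ ≟ˢ (⟦ i ⟧ ∪ ⁅ b ⁆)))
  oneInclusionGraph .adj-sym (inj₁ e) = inj₂ e
  oneInclusionGraph .adj-sym (inj₂ e) = inj₁ e

  WellGraded : Set
  WellGraded = ∀ i j → Distance oneInclusionGraph i j ∣ ⟦ i ⟧ △ ⟦ j ⟧ ∣

  trace : Subset n → List (Subset n)
  trace Y = deduplicate _≟ˢ_ (map (_∩ Y) (members S))

  Shattered : Subset n → Set
  Shattered Y = ∀ Z → Z ∈ trace Y ⇔ Z ⊆ Y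

  StronglyShattered : Subset n → Set
  StronglyShattered Y = ∃[ T ] T ⊆ ∁ Y × (∀ Z → Z ⊆ Y → (Z ∪ T) ∈ members S)

  Extremal : Set
  Extremal = ∀ Y → Shattered Y ⇔ StronglyShattered Y

  IsVCDimension : ℕ → Set
  IsVCDimension d = (∃[ Y ] Shattered Y × ∣ Y ∣ ≡ d) × (∀ Y → Shattered Y → ∣ Y ∣ ≤ d)

  Maximum : Set
  Maximum = ∃[ d ] IsVCDimension d ×
    (∀ Y → length (trace Y) ≡ sum (map (λ i → ∣ Y ∣ C i) (upTo (suc d))))

{-# OPTIONS --safe #-}
module Submission where

-- Write ~ for adjacency in the complement H of G, so that N_H(v) is the complement of N_G[v].
-- All conditions except maximality amount to one property: every non-isolated x occurs as a
-- label, N(p) = N(q) ⊎ {x}.  By symmetry of ~, the only neighbourhood separating p from q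
-- is then N(x); hence x is a label of p only, N(x) loses p in turn, every nonempty
-- neighbourhood covers another one and the neighbourhoods of two vertices with a common
-- neighbour are comparable.  So the neighbourhoods form chains that grow from ∅ along disjoint
-- sets of labels: this gives geodesics and excludes shattered pairs, and a maximal chain
-- together with its labels is a half-graph component of H.
-- A maximum system of positive VC-dimension on n points has at least 1 + n members, but there
-- are only n neighbourhoods.

open import Defs
open import Data.Bool using (Bool; true; false; not; _∧_; _∨_)
import Data.Bool.Properties as Bool
open import Data.Fin as Fin using (Fin; zero; suc; toℕ; inject₁; fromℕ<)
open import Data.Fin.Properties using (_≟_; any?; toℕ-inject₁; toℕ-fromℕ<; toℕ-injective; toℕ<n)
  renaming (≤-antisym to Fin-≤-antisym; ≤-refl to Fin-≤-refl)
open import Data.Fin.Subset as Subset using (Subset; ⁅_⁆; ⊤; ⊥; _∪_; _∩_; ∁; ∣_∣; _⊆_)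
open import Data.Fin.Subset.Properties
  using (_∈?_; nonempty?; Empty-unique; x∈⁅x⁆; x∈⁅y⁆⇒x≡y; x≢y⇒x∉⁅y⁆; ∉⊥; ⊥⊆; ⊆-antisym;
         p⊆p∪q; q⊆p∪q; x∈p∪q⁻; ∪-comm; ∪-identityˡ; p∩q⊆p; p∩q⊆q; x∈p∩q⁺; x∈p∩q⁻; ∩-identityʳ;
         x∈∁p⇒x∉p; x∉p⇒x∈∁p; ∣⊥∣≡0; ∣⊤∣≡n; p⊆q⇒∣p∣≤∣q∣; p⊂q⇒∣p∣<∣q∣)
open import Data.List as List using (List; []; _∷_; length; map; filter; allFin)
open import Data.List.Extrema.Nat using (argmax; f[xs]≤f[argmax]; argmax-all)
open import Data.List.Membership.Propositional using (_∈_; find)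
open import Data.List.Membership.Propositional.Properties
  using (∈-lookup; ∈-filter⁺; ∈-filter⁻; ∈-allFin; ∈-map⁺; ∈-map⁻;
         ∈-tabulate⁺; ∈-tabulate⁻; ∈-deduplicate⁺; ∈-deduplicate⁻)
open import Data.List.Properties using (filter-notAll; length-map; length-tabulate; length-deduplicate)
open import Data.List.Relation.Unary.All as All using (All; []; _∷_)
open import Data.List.Relation.Unary.AllPairs using ([]; _∷_)
open import Data.List.Relation.Unary.Any as Any using (here; there)
open import Data.List.Relation.Unary.Any.Properties using (lookup-index)
open import Data.List.Relation.Unary.Unique.DecPropositional.Properties using (deduplicate-!)
open import Data.List.Relation.Unary.Unique.Propositional using (Unique)
open import Data.List.Relation.Unary.Unique.Propositional.Properties using (filter⁺; allFin⁺)
open import Data.Nat using (ℕ; zero; suc; NonZero; >-nonZero⁻¹; _<_; _≤_; _<?_; z≤n; s≤s)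
open import Data.Nat.Combinatorics using (_C_; nC1≡n)
open import Data.Nat.Induction using (<-wellFounded)
open import Data.Nat.Properties
  using (≤-refl; ≤-reflexive; ≤-trans; ≤-antisym; ≤-pred; <⇒≤; <⇒≱; ≮⇒≥; ≰⇒>; ≤∧≢⇒<; <-≤-trans;
         n≤1+n; 1+n≰n; m≤m+n; suc-injective; module ≤-Reasoning)
open import Data.Product using (_×_; _,_; ∃; ∃₂; proj₁; proj₂)
open import Data.Sum using (_⊎_; inj₁; inj₂; [_,_]′)
open import Data.Sum.Properties using (inj₁-injective; inj₂-injective)
open import Data.Unit using (tt)
open import Data.Vec using (lookup; []; _∷_)
import Data.Vec.Functional as Vector
open import Data.Vec.Properties
  using (lookup-zipWith; lookup∘tabulate; tabulate∘lookup; tabulate-cong; []=⇒lookup; lookup⇒[]=)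
open import Function.Base using (_∘_; id)
open import Function.Bundles using (_⇔_; mk⇔; mk↔ₛ′; Equivalence; Injection; Inverse)
open import Function.Construct.Identity using (↔-id)
open import Function.Properties.Inverse using (↔⇒↣)
open import Induction.WellFounded using (Acc; acc)
open import Relation.Binary.PropositionalEquality
  using (_≡_; _≢_; refl; sym; trans; cong; cong₂; subst; subst₂; module ≡-Reasoning)
open import Relation.Nullary using (¬_; Dec; yes; no; contradiction)
open import Relation.Nullary.Decidable using (does; decidable-stable; dec-true; dec-false; ¬?; _×-dec_)

private
  variable
    k m n : ℕ
    A V W : Set
    P Q R : Subset n

-- Covers between neighbourhoods and descent along them.

-- N(p) is the disjoint union of N(q) and {x}.
record Covers (_~_ : V → V → Set) (p q x : V) : Set where
  field
    has   : p ~ x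
    lacks : ¬ q ~ x
    grow  : ∀ {y} → q ~ y → p ~ y
    drop  : ∀ {y} → y ≢ x → p ~ y → q ~ y

open Covers

Covered : (V → V → Set) → Set
Covered _~_ = ∀ {v x} → v ~ x → ∃₂ λ p q → Covers _~_ p q x

module _ (H : Graph (Fin n)) where

  ∈N⁺ : ∀ {v w} → Adj H v w → w Subset.∈ N H v
  ∈N⁺ {v} {w} vw = lookup⇒[]= w (N H v)
    (trans (lookup∘tabulate _ w) (dec-true (adj? H v w) vw))

  ∈N⁻ : ∀ {v w} → w Subset.∈ N H v → Adj H v w
  ∈N⁻ {v} {w} w∈Nv
    with adj? H v w | trans (sym (lookup∘tabulate (does ∘ adj? H v) w)) ([]=⇒lookup w∈Nv)
  ... | yes vw | _ = vw

module NeighbourhoodChains (H : Graph (Fin n)) (irrefl : Loopless H)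
                           (covered : Covered (Adj H)) where

  private
    _~_ = Adj H

    flip~ : ∀ {v w} → v ~ w → w ~ v
    flip~ = adj-sym H

  -- If `r` were not `x`, then r in N(p) would survive in N(q). Hence q, which differs from the lost
  -- label p, would lie in N(r) and so in N(s). Then s would lie in N(q), hence in N(p), although
  -- N(s) lacks p.
  cover-of-cover : ∀ {p q x r s} → Covers _~_ p q x → Covers _~_ r s p → r ≡ x
  cover-of-cover {p} {q} {x} {r} {s} c d with r ≟ x
  ... | yes r≡x = r≡x
  ... | no  r≢x = contradiction (flip~ (grow c (flip~ s~q))) (lacks d)
    where
    s~q : s ~ q
    s~q = drop d (λ { refl → lacks c (has c) }) (flip~ (drop c r≢x (flip~ (has d))))

  -- The vertex `p` is itself non-isolated, hence a label; by `cover-of-cover` the neighbourhood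
  -- that loses it is N(x). So a vertex and its label exchange roles.
  covers-flip : ∀ {p q x} → Covers _~_ p q x → ∃ λ s → Covers _~_ x s p
  covers-flip c with covered (flip~ (has c))
  ... | r , s , d with refl ← cover-of-cover c d = s , d

  cover-unique : ∀ {p q p′ q′ x} → Covers _~_ p q x → Covers _~_ p′ q′ x → p′ ≡ p
  cover-unique c c′ with s , d ← covers-flip c = cover-of-cover d c′

  -- A non-isolated `v` is the label of some cover; flipping that cover puts `v` on top.
  predecessor : ∀ {v x} → v ~ x → ∃₂ λ q w → Covers _~_ v q w
  predecessor v~x
    with p , q , c ← covered (flip~ v~x)
    with s , d ← covers-flip c = s , p , d

  degree : Fin n → ℕ
  degree v = ∣ N H v ∣

  covers⇒degree< : ∀ {p q x} → Covers _~_ p q x → degree q < degree p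
  covers⇒degree< c = p⊂q⇒∣p∣<∣q∣
    ((λ y∈Nq → ∈N⁺ H (grow c (∈N⁻ H y∈Nq))) , _ , ∈N⁺ H (has c) , λ x∈Nq → lacks c (∈N⁻ H x∈Nq))

  -- Induction along covers is well-founded because the degree drops.
  covers-rec : (P : Fin n → Set) → (∀ v → (∀ {q x} → Covers _~_ v q x → P q) → P v) → ∀ v → P v
  covers-rec P step v = go v (<-wellFounded (degree v))
    where
    go : ∀ v → Acc _<_ (degree v) → P v
    go v (acc rs) = step v (λ {q} c → go q (rs (covers⇒degree< c)))

  -- Descend from `u` while `x` is still a neighbour. The step that loses `x` starts at `p` by
  -- `cover-unique`, and descending only shrinks neighbourhoods.
  least-above-label : ∀ {p q x} → Covers _~_ p q x → ∀ u → u ~ x → ∀ {y} → p ~ y → u ~ y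
  least-above-label {p} {x = x} c = covers-rec _ step
    where
    step : ∀ u → (∀ {q w} → Covers _~_ u q w → q ~ x → ∀ {y} → p ~ y → q ~ y) →
           u ~ x → ∀ {y} → p ~ y → u ~ y
    step u rec u~x p~y with predecessor u~x
    ... | r , t , d with x ≟ t
    ... | yes refl with refl ← cover-unique c d = p~y
    ... | no  x≢t  = grow d (rec d (drop d x≢t u~x) p~y)

  -- Descend from `w` until `u` or `v` is the label lost. If it is `u`, then every neighbourhood
  -- containing `u` contains the current one and hence `v`; by symmetry of `~` this says that N(u)
  -- lies in N(v).
  comparable : ∀ w {u v} → w ~ u → w ~ v →
               (∀ {y} → u ~ y → v ~ y) ⊎ (∀ {y} → v ~ y → u ~ y)
  comparable = covers-rec _ step
    where
    step : ∀ w → (∀ {q x} → Covers _~_ w q x → ∀ {u v} → q ~ u → q ~ v →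
             (∀ {y} → u ~ y → v ~ y) ⊎ (∀ {y} → v ~ y → u ~ y)) →
           ∀ {u v} → w ~ u → w ~ v →
           (∀ {y} → u ~ y → v ~ y) ⊎ (∀ {y} → v ~ y → u ~ y)
    step w rec {u} {v} w~u w~v with predecessor w~u
    ... | r , t , d with u ≟ t | v ≟ t
    ... | yes refl | _ = inj₁ (λ u~y → flip~ (least-above-label d _ (flip~ u~y) w~v))
    ... | no _ | yes refl = inj₂ (λ v~y → flip~ (least-above-label d _ (flip~ v~y) w~u))
    ... | no u≢t | no v≢t = rec d (drop d u≢t w~u) (drop d v≢t w~v)

  -- Every descent ends at the empty neighbourhood. The vertex found here later makes the complete
  -- part nonempty.
  isolated : Fin n → ∃ λ o → ∀ y → ¬ o ~ y
  isolated = covers-rec _ step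
    where
    step : ∀ v → (∀ {q x} → Covers _~_ v q x → ∃ λ o → ∀ y → ¬ o ~ y) → ∃ λ o → ∀ y → ¬ o ~ y
    step v rec with any? (adj? H v)
    ... | no  ∄y = v , λ y v~y → ∄y (y , v~y)
    ... | yes (y , v~y) with r , t , d ← predecessor v~y = rec d

-- Auxiliary facts on lists and finite types.

lookup-injective : {xs : List A} → Unique xs → ∀ {i j} → List.lookup xs i ≡ List.lookup xs j → i ≡ j
lookup-injective (_ ∷ _)    {zero}  {zero}  _  = refl
lookup-injective (x∉xs ∷ _) {zero}  {suc j} eq = contradiction eq (All.lookup x∉xs (∈-lookup j))
lookup-injective (x∉xs ∷ _) {suc i} {zero}  eq = contradiction (sym eq) (All.lookup x∉xs (∈-lookup i))
lookup-injective (_ ∷ uxs)  {suc i} {suc j} eq = cong suc (lookup-injective uxs eq)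

maximum : (f : A → ℕ) {xs : List A} {x : A} → x ∈ xs →
          ∃ λ m → m ∈ xs × (∀ {y} → y ∈ xs → f y ≤ f m)
maximum f {xs} {x} x∈xs = argmax f x xs , argmax-all f x∈xs (All.tabulate id)
                        , All.lookup (f[xs]≤f[argmax] x xs)

Fin⇒nonZero : Fin n → NonZero n
Fin⇒nonZero {suc _} _ = _

vertex : ∀ n .{{_ : NonZero n}} → Fin n
vertex n = Fin.fromℕ< (>-nonZero⁻¹ n)

complement-irrefl : (G : Graph (Fin n)) → Loopless (complement G)
complement-irrefl G v (v≢v , _) = v≢v refl

-- From the covering property to co-half-graphs.

module Decomposition (G : Graph (Fin n)) (loopless : Loopless G)
                     (covered : Covered (Adj (complement G))) where

  private
    H = complement G
    _~_ = Adj H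

    flip~ : ∀ {v w} → v ~ w → w ~ v
    flip~ = adj-sym H

  open NeighbourhoodChains H (complement-irrefl G) covered

  adj⁺ : ∀ {v w} → v ≢ w → ¬ v ~ w → Adj G v w
  adj⁺ {v} {w} v≢w v≁w = decidable-stable (adj? G v w) (λ ¬vw → v≁w (v≢w , ¬vw))

  adj⇒≢ : ∀ {v w} → Adj G v w → v ≢ w
  adj⇒≢ vw refl = loopless _ vw

  -- y 0, y 1, … have the decreasing neighbourhoods that lie below N(v), starting with v
  -- itself, and x i is the vertex lost in the i-th step.
  record Chain (v : Fin n) : Set where
    field
      len        : ℕ
      y x        : Fin len → Fin n
      ≤⇒~        : ∀ {i j} → i Fin.≤ j → y i ~ x j
      ~⇒≤        : ∀ {i j} → y i ~ x j → i Fin.≤ j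
      y-covers   : ∀ i → ∃ λ r → Covers _~_ (y i) r (x i)
      x-adjacent : ∀ i → v ~ x i
      adjacent-x : ∀ {w} → v ~ w → ∃ λ i → w ≡ x i
      y-below    : ∀ i {w} → y i ~ w → v ~ w

  chain : ∀ v → Chain v
  chain = covers-rec Chain step
    where
    step : ∀ v → (∀ {q x} → Covers _~_ v q x → Chain q) → Chain v
    step v rec with any? (adj? H v)
    ... | no ∄w = record
      { len = 0 ; y = λ () ; x = λ ()
      ; ≤⇒~ = λ { {()} } ; ~⇒≤ = λ { {()} } ; y-covers = λ ()
      ; x-adjacent = λ () ; adjacent-x = λ v~w → contradiction (_ , v~w) ∄w ; y-below = λ () }
    ... | yes (_ , v~w) with q , t , c ← predecessor v~w = record
      { len = suc Rest.len
      ; y = v Vector.∷ Rest.y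
      ; x = t Vector.∷ Rest.x
      ; ≤⇒~ = λ { {zero} {zero} _ → has c
                ; {zero} {suc j} _ → grow c (Rest.x-adjacent j)
                ; {suc i} {suc j} (s≤s i≤j) → Rest.≤⇒~ i≤j }
      ; ~⇒≤ = λ { {zero} _ → z≤n
                ; {suc i} {zero} yi~t → contradiction (Rest.y-below i yi~t) (lacks c)
                ; {suc i} {suc j} yi~xj → s≤s (Rest.~⇒≤ yi~xj) }
      ; y-covers = λ { zero → q , c ; (suc i) → Rest.y-covers i }
      ; x-adjacent = λ { zero → has c ; (suc i) → grow c (Rest.x-adjacent i) }
      ; adjacent-x = adjacent-x
      ; y-below = λ { zero → id ; (suc i) yi~w → grow c (Rest.y-below i yi~w) } }
      where
      module Rest = Chain (rec c)
      adjacent-x : ∀ {w} → v ~ w → ∃ λ i → w ≡ (t Vector.∷ Rest.x) i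
      adjacent-x {w} v~w with w ≟ t
      ... | yes w≡t = zero , w≡t
      ... | no  w≢t with i , w≡xi ← Rest.adjacent-x (drop c w≢t v~w) = suc i , w≡xi

  -- Relative to a list of vertices, so that components of `H` can be split off one at a time.
  record Decomposed (L : List (Fin n)) : Set where
    field
      orders         : List ℕ
      rest           : ℕ
      orders-nonZero : All NonZero orders
      rest-nonZero   : NonZero rest
      embed          : UnionVertex orders rest → Fin n
      embed-∈        : ∀ a → embed a ∈ L
      embed-onto     : ∀ {v} → v ∈ L → ∃ λ a → embed a ≡ v
      embed-inj      : ∀ {a b} → embed a ≡ embed b → a ≡ b
      embed-adj      : ∀ a b → Adj G (embed a) (embed b) ⇔ Adj (coHalfUnion orders rest) a b

  -- Such an `L` is a union of connected components of `H`.
  Closed : List (Fin n) → Set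
  Closed L = ∀ {u w} → u ∈ L → u ~ w → w ∈ L

  Maximal : Fin n → Set
  Maximal v = ∀ {u x} → u ~ x → (∀ {y} → v ~ y → u ~ y) → ∀ {y} → u ~ y → v ~ y

  -- With no `~` left on `L`, its distinct vertices are pairwise adjacent in `G`, and their
  -- positions in `L` serve as the vertices of a complete graph.
  isolated-decomposed : ∀ {L o} → Unique L → (∀ {v} → v ∈ L → ∀ w → ¬ v ~ w) → o ∈ L → Decomposed L
  isolated-decomposed {L} uL none o∈L = record
    { orders = [] ; rest = length L ; orders-nonZero = []
    ; rest-nonZero = Fin⇒nonZero (Any.index o∈L)
    ; embed = List.lookup L
    ; embed-∈ = ∈-lookup
    ; embed-onto = λ v∈L → Any.index v∈L , sym (lookup-index v∈L)
    ; embed-inj = lookup-injective uL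
    ; embed-adj = λ a b → mk⇔ (λ vw a≡b → adj⇒≢ vw (cong (List.lookup L) a≡b))
        (λ a≢b → adj⁺ (a≢b ∘ lookup-injective uL) (none (∈-lookup a) _))
    }

  -- The chain of a maximal v together with its labels is a connected component of H.
  module Peel {L v} (uL : Unique L) (closed : Closed L) (v∈L : v ∈ L)
              (maximal : Maximal v) (ch : Chain v) where
    open Chain ch

    -- As `u` and `v` share the neighbour `x j`, their neighbourhoods are comparable, and maximality
    -- puts N(u) inside N(v). The label lost below `u` is therefore some `x i`, and a label has only
    -- one top, namely `y i`.
    adjacent-y : ∀ {u} j → u ~ x j → ∃ λ i → u ≡ y i
    adjacent-y {u} j u~xj with predecessor u~xj
    ... | r , t , d with adjacent-x (Nu⊆Nv (has d))
      where
      Nu⊆Nv : ∀ {z} → u ~ z → v ~ z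
      Nu⊆Nv with comparable (x j) (flip~ u~xj) (flip~ (x-adjacent j))
      ... | inj₁ u⊆v = u⊆v
      ... | inj₂ v⊆u = maximal u~xj v⊆u
    ... | i , refl = i , cover-unique (proj₂ (y-covers i)) d

    -- Equality would put `v` into N(`y i`), which lies in N(v), so `v` would be its own neighbour.
    y≢x : ∀ i j → y i ≢ x j
    y≢x i j yi≡xj
      with i′ , v≡yi′ ← adjacent-y j (x-adjacent j)
      with k , v≡xk ← adjacent-x (y-below i (flip~ (subst (v ~_) (sym yi≡xj) (x-adjacent j))))
      = complement-irrefl G v (subst (v ~_) (sym v≡xk) (x-adjacent k))

    y≁y : ∀ i j → ¬ y i ~ y j
    y≁y i j yi~yj with k , yj≡xk ← adjacent-x (y-below i yi~yj) = y≢x j k yj≡xk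

    x≁x : ∀ i j → ¬ x i ~ x j
    x≁x i j xi~xj with k , xi≡yk ← adjacent-y j xi~xj = y≢x k i (sym xi≡yk)

    y-inj : ∀ {i j} → y i ≡ y j → i ≡ j
    y-inj {i} {j} yi≡yj = Fin-≤-antisym
      (~⇒≤ (subst (_~ x j) (sym yi≡yj) (≤⇒~ Fin-≤-refl)))
      (~⇒≤ (subst (_~ x i) yi≡yj (≤⇒~ Fin-≤-refl)))

    x-inj : ∀ {i j} → x i ≡ x j → i ≡ j
    x-inj {i} {j} xi≡xj = Fin-≤-antisym
      (~⇒≤ (subst (y i ~_) xi≡xj (≤⇒~ Fin-≤-refl)))
      (~⇒≤ (subst (y j ~_) (sym xi≡xj) (≤⇒~ Fin-≤-refl)))

    Outside : Fin n → Set
    Outside u = (¬ ∃ λ i → u ≡ y i) × (¬ ∃ λ i → u ≡ x i)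

    outside? : ∀ u → Dec (Outside u)
    outside? u = ¬? (any? (λ i → u ≟ y i)) ×-dec ¬? (any? (λ i → u ≟ x i))

    L′ : List (Fin n)
    L′ = filter outside? L

    L′-closed : Closed L′
    L′-closed {u} {w} u∈L′ u~w with ∈-filter⁻ outside? u∈L′
    ... | u∈L , ¬y , ¬x = ∈-filter⁺ outside? (closed u∈L u~w)
      ( (λ { (i , refl) → ¬x (adjacent-x (y-below i (flip~ u~w))) })
      , (λ { (i , refl) → ¬y (adjacent-y i u~w) }))

    isolated-outside : ∀ {o} → (∀ w → ¬ o ~ w) → Outside o
    isolated-outside iso = (λ { (i , refl) → iso (x i) (≤⇒~ Fin-≤-refl) })
                         , (λ { (i , refl) → iso (y i) (flip~ (≤⇒~ Fin-≤-refl)) })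

    x∈L : ∀ i → x i ∈ L
    x∈L i = closed v∈L (x-adjacent i)

    y∈L : ∀ i → y i ∈ L
    y∈L i = closed (x∈L i) (flip~ (≤⇒~ Fin-≤-refl))

    L′-shorter : Fin len → length L′ < length L
    L′-shorter i = filter-notAll outside? L
      (Any.map (λ { refl (¬y , _) → ¬y (i , refl) }) (y∈L i))

    -- The `y i` act as the vertices aᵢ and the `x i` as the bᵢ. All neighbours in `H` of chain
    -- vertices are in the chain, so in `G` the chain is fully joined to the rest.
    extend : Fin len → Decomposed L′ → Decomposed L
    extend i₀ D = record
      { orders = len ∷ D.orders
      ; rest = D.rest
      ; orders-nonZero = Fin⇒nonZero i₀ ∷ D.orders-nonZero
      ; rest-nonZero = D.rest-nonZero
      ; embed = embed
      ; embed-∈ = λ { (inj₁ (inj₁ i)) → y∈L i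
                    ; (inj₁ (inj₂ i)) → x∈L i
                    ; (inj₂ a) → proj₁ (∈-filter⁻ outside? (D.embed-∈ a)) }
      ; embed-onto = onto
      ; embed-inj = λ {a} {b} → injective a b
      ; embed-adj = λ a b → mk⇔ (adj⇒ a b) (⇒adj a b)
      }
      where
      module D = Decomposed D

      embed : (Fin len ⊎ Fin len) ⊎ UnionVertex D.orders D.rest → Fin n
      embed (inj₁ (inj₁ i)) = y i
      embed (inj₁ (inj₂ i)) = x i
      embed (inj₂ a)        = D.embed a

      outside : ∀ a → Outside (D.embed a)
      outside a = proj₂ (∈-filter⁻ outside? {xs = L} (D.embed-∈ a))

      onto : ∀ {v} → v ∈ L → ∃ λ a → embed a ≡ v
      onto {v} v∈L with any? (λ i → v ≟ y i) | any? (λ i → v ≟ x i)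
      ... | yes (i , v≡yi) | _ = inj₁ (inj₁ i) , sym v≡yi
      ... | no _ | yes (i , v≡xi) = inj₁ (inj₂ i) , sym v≡xi
      ... | no ¬y | no ¬x with a , eq ← D.embed-onto (∈-filter⁺ outside? v∈L (¬y , ¬x)) = inj₂ a , eq

      injective : ∀ a b → embed a ≡ embed b → a ≡ b
      injective (inj₁ (inj₁ i)) (inj₁ (inj₁ j)) eq = cong (inj₁ ∘ inj₁) (y-inj eq)
      injective (inj₁ (inj₁ i)) (inj₁ (inj₂ j)) eq = contradiction eq (y≢x i j)
      injective (inj₁ (inj₂ i)) (inj₁ (inj₁ j)) eq = contradiction (sym eq) (y≢x j i)
      injective (inj₁ (inj₂ i)) (inj₁ (inj₂ j)) eq = cong (inj₁ ∘ inj₂) (x-inj eq)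
      injective (inj₁ (inj₁ i)) (inj₂ b) eq = contradiction (i , sym eq) (proj₁ (outside b))
      injective (inj₁ (inj₂ i)) (inj₂ b) eq = contradiction (i , sym eq) (proj₂ (outside b))
      injective (inj₂ a) (inj₁ (inj₁ i)) eq = contradiction (i , eq) (proj₁ (outside a))
      injective (inj₂ a) (inj₁ (inj₂ i)) eq = contradiction (i , eq) (proj₂ (outside a))
      injective (inj₂ a) (inj₂ b) eq = cong inj₂ (D.embed-inj eq)

      y-adj : ∀ i a → Adj G (y i) (D.embed a)
      y-adj i a = adj⁺ (λ eq → proj₁ (outside a) (i , sym eq))
        (λ yi~a → proj₂ (outside a) (adjacent-x (y-below i yi~a)))

      x-adj : ∀ i a → Adj G (x i) (D.embed a)
      x-adj i a = adj⁺ (λ eq → proj₂ (outside a) (i , sym eq))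
        (λ xi~a → proj₁ (outside a) (adjacent-y i (flip~ xi~a)))

      yx⇒> : ∀ i j → Adj G (y i) (x j) → i Fin.> j
      yx⇒> i j yx = ≰⇒> (λ i≤j → proj₂ (≤⇒~ i≤j) yx)

      >⇒yx : ∀ i j → i Fin.> j → Adj G (y i) (x j)
      >⇒yx i j i>j = adj⁺ (y≢x i j) (λ yi~xj → <⇒≱ i>j (~⇒≤ yi~xj))

      adj⇒ : ∀ a b → Adj G (embed a) (embed b) → Adj (coHalfUnion (len ∷ D.orders) D.rest) a b
      adj⇒ (inj₁ (inj₁ i)) (inj₁ (inj₁ j)) ab refl = loopless _ ab
      adj⇒ (inj₁ (inj₁ i)) (inj₁ (inj₂ j)) ab = yx⇒> i j ab
      adj⇒ (inj₁ (inj₂ i)) (inj₁ (inj₁ j)) ab = yx⇒> j i (adj-sym G ab)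
      adj⇒ (inj₁ (inj₂ i)) (inj₁ (inj₂ j)) ab refl = loopless _ ab
      adj⇒ (inj₁ _) (inj₂ _) _ = tt
      adj⇒ (inj₂ _) (inj₁ _) _ = tt
      adj⇒ (inj₂ a) (inj₂ b) ab = Equivalence.to (D.embed-adj a b) ab

      ⇒adj : ∀ a b → Adj (coHalfUnion (len ∷ D.orders) D.rest) a b → Adj G (embed a) (embed b)
      ⇒adj (inj₁ (inj₁ i)) (inj₁ (inj₁ j)) i≢j = adj⁺ (i≢j ∘ y-inj) (y≁y i j)
      ⇒adj (inj₁ (inj₁ i)) (inj₁ (inj₂ j)) i>j = >⇒yx i j i>j
      ⇒adj (inj₁ (inj₂ i)) (inj₁ (inj₁ j)) j>i = adj-sym G (>⇒yx j i j>i)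
      ⇒adj (inj₁ (inj₂ i)) (inj₁ (inj₂ j)) i≢j = adj⁺ (i≢j ∘ x-inj) (x≁x i j)
      ⇒adj (inj₁ (inj₁ i)) (inj₂ b) _ = y-adj i b
      ⇒adj (inj₁ (inj₂ i)) (inj₂ b) _ = x-adj i b
      ⇒adj (inj₂ a) (inj₁ (inj₁ i)) _ = adj-sym G (y-adj i a)
      ⇒adj (inj₂ a) (inj₁ (inj₂ i)) _ = adj-sym G (x-adj i a)
      ⇒adj (inj₂ a) (inj₂ b) ab = Equivalence.from (D.embed-adj a b) ab

  maximal-vertex : ∀ {L u z} → Closed L → u ∈ L → u ~ z →
                   ∃₂ λ v w → v ∈ L × v ~ w × Maximal v
  maximal-vertex {L} {u} {z} closed u∈L u~z with maximum degree u∈L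
  ... | v , v∈L , largest = v , proj₁ positive , v∈L , proj₂ positive , maximal
    where
    positive : ∃ λ w → v ~ w
    positive with any? (adj? H v)
    ... | yes ∃w = ∃w
    -- If N(v) were empty, the degree of `v` would be at most that of `q`, which is below that of
    -- `u`, contrary to the choice of `v`.
    ... | no ∄w with q , t , c ← predecessor u~z = contradiction
      (p⊆q⇒∣p∣≤∣q∣ {p = N H v} {q = N H q} (λ w∈Nv → contradiction (_ , ∈N⁻ H w∈Nv) ∄w))
      (<⇒≱ (<-≤-trans (covers⇒degree< c) (largest u∈L)))

    maximal : Maximal v
    maximal {w} w~x v⊆w {y} w~y with adj? H v y
    ... | yes v~y = v~y
    ... | no  v≁y = contradiction (largest w∈L)
      (<⇒≱ (p⊂q⇒∣p∣<∣q∣ ((λ ∈Nv → ∈N⁺ H (v⊆w (∈N⁻ H ∈Nv))) , y , ∈N⁺ H w~y , λ ∈Nv → v≁y (∈N⁻ H ∈Nv))))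
      where
      -- Only vertices of `L` compete in degree; `w` is one because it shares a neighbour with `v`.
      w∈L : w ∈ L
      w∈L = closed (closed v∈L (proj₂ positive)) (flip~ (v⊆w (proj₂ positive)))

  -- Components are peeled off until no edge of `H` remains. The isolated `o` is never removed, so
  -- the remaining complete graph has a vertex.
  decompose : ∀ {L o} → Acc _<_ (length L) → Unique L → Closed L → o ∈ L → (∀ w → ¬ o ~ w) →
              Decomposed L
  decompose {L} {o} (acc rs) uL closed o∈L o-isolated with Any.any? (λ v → any? (adj? H v)) L
  ... | no none = isolated-decomposed uL
    (λ v∈L w v~w → none (Any.map (λ { refl → w , v~w }) v∈L)) o∈L
  ... | yes some
    with u , u∈L , z , u~z ← find some
    with v , w , v∈L , v~w , maximal ← maximal-vertex closed u∈L u~z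
    with ch ← chain v
    with i₀ , _ ← Chain.adjacent-x ch v~w =
    let open Peel uL closed v∈L maximal ch in
      extend i₀ (decompose (rs (L′-shorter i₀)) (filter⁺ outside? uL) L′-closed
        (∈-filter⁺ outside? o∈L (isolated-outside o-isolated)) o-isolated)

  decomposed⇒≅ : (D : Decomposed (allFin n)) →
    G ≅ coHalfUnion (Decomposed.orders D) (Decomposed.rest D)
  decomposed⇒≅ D = record
    { bijection = mk↔ₛ′ index embed (λ a → embed-inj (embed-index _)) embed-index
    ; preserves = λ v w → subst₂ (λ v′ w′ → Adj G v′ w′ ⇔ Adj (coHalfUnion orders rest) (index v) (index w))
        (embed-index v) (embed-index w) (embed-adj (index v) (index w)) }
    where
    open Decomposed D

    index : Fin n → UnionVertex orders rest
    index v = proj₁ (embed-onto (∈-allFin v))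

    embed-index : ∀ v → embed (index v) ≡ v
    embed-index v = proj₂ (embed-onto (∈-allFin v))

  classification : Fin n → IsComplete G ⊎ IsUnionOfCoHalfGraphsAndComplete G
  classification v₀ with isolated v₀
  ... | o , o-isolated = classify orders orders-nonZero (decomposed⇒≅ D)
    where
    D : Decomposed (allFin n)
    D = decompose (<-wellFounded _) (allFin⁺ n) (λ _ _ → ∈-allFin _) (∈-allFin o) o-isolated

    open Decomposed D

    classify : ∀ ks → All NonZero ks → G ≅ coHalfUnion ks rest →
               IsComplete G ⊎ IsUnionOfCoHalfGraphsAndComplete G
    classify []       _  G≅ = inj₁ (rest , rest-nonZero , G≅)
    classify (k ∷ ks) nz G≅ = inj₂ (k ∷ ks , rest , (λ ()) , nz , rest-nonZero , G≅)

-- Unions of co-half-graphs have the covering property.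

-- Adjacency in the complement for an arbitrary vertex type; on `Fin n` it agrees definitionally
-- with `Adj (complement G)`.
NonAdj : Graph V → V → V → Set
NonAdj G v w = v ≢ w × ¬ Adj G v w

a≁b⇒≤ : ∀ {i j : Fin k} → NonAdj (coHalfGraph k) (inj₁ i) (inj₂ j) → i Fin.≤ j
a≁b⇒≤ (_ , i≯j) = ≮⇒≥ i≯j

≤⇒a≁b : ∀ {i j : Fin k} → i Fin.≤ j → NonAdj (coHalfGraph k) (inj₁ i) (inj₂ j)
≤⇒a≁b i≤j = (λ ()) , λ i>j → <⇒≱ i>j i≤j

a≁a : ∀ {i j : Fin k} → ¬ NonAdj (coHalfGraph k) (inj₁ i) (inj₁ j)
a≁a (a≢a , ¬i≢j) = ¬i≢j (a≢a ∘ cong inj₁)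

b≁b : ∀ {i j : Fin k} → ¬ NonAdj (coHalfGraph k) (inj₂ i) (inj₂ j)
b≁b (b≢b , ¬i≢j) = ¬i≢j (b≢b ∘ cong inj₂)

nonAdj-sym : (G : Graph V) → ∀ {v w} → NonAdj G v w → NonAdj G w v
nonAdj-sym G (v≢w , ¬vw) = v≢w ∘ sym , ¬vw ∘ adj-sym G

module _ (G : Graph V) (H : Graph W) where

  private
    _≁_ = NonAdj (betweenFullUnion G H)

  left⁺ : ∀ {v w} → NonAdj G v w → inj₁ v ≁ inj₁ w
  left⁺ (v≢w , ¬vw) = v≢w ∘ inj₁-injective , ¬vw

  left⁻ : ∀ {v w} → inj₁ v ≁ inj₁ w → NonAdj G v w
  left⁻ (v≢w , ¬vw) = v≢w ∘ cong inj₁ , ¬vw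

  right⁺ : ∀ {v w} → NonAdj H v w → inj₂ v ≁ inj₂ w
  right⁺ (v≢w , ¬vw) = v≢w ∘ inj₂-injective , ¬vw

  right⁻ : ∀ {v w} → inj₂ v ≁ inj₂ w → NonAdj H v w
  right⁻ (v≢w , ¬vw) = v≢w ∘ cong inj₂ , ¬vw

  left-covers : ∀ {p q x} → Covers (NonAdj G) p q x → Covers _≁_ (inj₁ p) (inj₁ q) (inj₁ x)
  left-covers c .has = left⁺ (has c)
  left-covers c .lacks q≁x = lacks c (left⁻ q≁x)
  left-covers c .grow {inj₁ y} q≁y = left⁺ (grow c (left⁻ q≁y))
  left-covers c .grow {inj₂ y} (_ , ¬tt) = contradiction tt ¬tt
  left-covers c .drop {inj₁ y} y≢x p≁y = left⁺ (drop c (y≢x ∘ cong inj₁) (left⁻ p≁y))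
  left-covers c .drop {inj₂ y} _ (_ , ¬tt) = contradiction tt ¬tt

  right-covers : ∀ {p q x} → Covers (NonAdj H) p q x → Covers _≁_ (inj₂ p) (inj₂ q) (inj₂ x)
  right-covers c .has = right⁺ (has c)
  right-covers c .lacks q≁x = lacks c (right⁻ q≁x)
  right-covers c .grow {inj₂ y} q≁y = right⁺ (grow c (right⁻ q≁y))
  right-covers c .grow {inj₁ y} (_ , ¬tt) = contradiction tt ¬tt
  right-covers c .drop {inj₂ y} y≢x p≁y = right⁺ (drop c (y≢x ∘ cong inj₂) (right⁻ p≁y))
  right-covers c .drop {inj₁ y} _ (_ , ¬tt) = contradiction tt ¬tt

-- N(p) = {x}, with the empty neighbourhood provided by a further isolated vertex.
CoversEmpty : (V → V → Set) → V → V → Set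
CoversEmpty _~_ p x = p ~ x × (∀ {y} → p ~ y → y ≡ x)

-- The complement of a co-half-graph has no isolated vertex, so its singleton neighbourhoods cover
-- an empty one from another part of the union.
union-covers-isolated : (G : Graph V) (H : Graph W) → ∀ {p x o} → CoversEmpty (NonAdj G) p x →
  (∀ w → ¬ NonAdj H o w) → Covers (NonAdj (betweenFullUnion G H)) (inj₁ p) (inj₂ o) (inj₁ x)
union-covers-isolated G H (p≁x , only) iso .has = left⁺ G H p≁x
union-covers-isolated G H (p≁x , only) iso .lacks (_ , ¬tt) = ¬tt tt
union-covers-isolated G H (p≁x , only) iso .grow {inj₁ y} (_ , ¬tt) = contradiction tt ¬tt
union-covers-isolated G H (p≁x , only) iso .grow {inj₂ y} o≁y = contradiction (right⁻ G H o≁y) (iso y)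
union-covers-isolated G H (p≁x , only) iso .drop {inj₁ y} y≢x p≁y =
  contradiction (cong inj₁ (only (left⁻ G H p≁y))) y≢x
union-covers-isolated G H (p≁x , only) iso .drop {inj₂ y} y≢x (_ , ¬tt) = contradiction tt ¬tt

-- In the complement aᵢ is adjacent to bⱼ iff i ≤ j. Thus N(bⱼ) grows with j, gaining aⱼ from
-- N(bⱼ₋₁), and N(aⱼ) shrinks, losing bⱼ on passing to N(aⱼ₊₁). The first a and the last b are
-- labels of singletons.
coHalfGraph-covers : ∀ {v x} → NonAdj (coHalfGraph k) v x →
  ∃ λ p → CoversEmpty (NonAdj (coHalfGraph k)) p x ⊎ ∃ λ q → Covers (NonAdj (coHalfGraph k)) p q x
coHalfGraph-covers {x = inj₁ zero} _ = inj₂ zero , inj₁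
  ( nonAdj-sym (coHalfGraph _) {inj₁ zero} {inj₂ zero} (≤⇒a≁b ≤-refl)
  , λ { {inj₁ zero} _ → refl
      ; {inj₁ (suc i)} b≁a → contradiction (a≁b⇒≤ (nonAdj-sym (coHalfGraph _) {inj₂ zero} {inj₁ (suc i)} b≁a)) (λ ())
      ; {inj₂ _} b~b → contradiction b~b b≁b } )
coHalfGraph-covers {k} {x = inj₁ (suc i)} _ = inj₂ (suc i) , inj₂ (inj₂ (inject₁ i) , c)
  where
  K = coHalfGraph k
  flip : ∀ {v w} → NonAdj K v w → NonAdj K w v
  flip {v} {w} = nonAdj-sym K {v} {w}

  ba⁺ : ∀ {i j} → i Fin.≤ j → NonAdj K (inj₂ j) (inj₁ i)
  ba⁺ {i} {j} i≤j = flip {inj₁ i} {inj₂ j} (≤⇒a≁b i≤j)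

  ba⁻ : ∀ {i j} → NonAdj K (inj₂ j) (inj₁ i) → i Fin.≤ j
  ba⁻ {i} {j} b≁a = a≁b⇒≤ (flip {inj₂ j} {inj₁ i} b≁a)

  c : Covers (NonAdj K) (inj₂ (suc i)) (inj₂ (inject₁ i)) (inj₁ (suc i))
  c .has = ba⁺ ≤-refl
  c .lacks b≁a = 1+n≰n (≤-trans (ba⁻ b≁a) (≤-reflexive (toℕ-inject₁ i)))
  c .grow {inj₁ j} b≁a = ba⁺ (≤-trans (ba⁻ b≁a) (≤-trans (≤-reflexive (toℕ-inject₁ i)) (n≤1+n _)))
  c .grow {inj₂ j} b~b = contradiction b~b b≁b
  c .drop {inj₁ j} j≢ b≁a = ba⁺ (≤-trans (≤-pred (≤∧≢⇒< (ba⁻ b≁a) (j≢ ∘ cong inj₁ ∘ toℕ-injective)))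
                                   (≤-reflexive (sym (toℕ-inject₁ i))))
  c .drop {inj₂ j} _ b~b = contradiction b~b b≁b
coHalfGraph-covers {k} {x = inj₂ j} _ with suc (toℕ j) <? k
... | no 1+j≮k = inj₁ j , inj₁
  ( ≤⇒a≁b ≤-refl
  , λ { {inj₁ _} a~a → contradiction a~a a≁a
      ; {inj₂ i} a≁b → cong inj₂ (toℕ-injective (≤-antisym
          (≤-pred (≤-trans (toℕ<n i) (≮⇒≥ 1+j≮k))) (a≁b⇒≤ a≁b))) } )
... | yes 1+j<k = inj₁ j , inj₂ (inj₁ j⁺ , c)
  where
  j⁺ : Fin k
  j⁺ = fromℕ< 1+j<k

  j⁺≡ : toℕ j⁺ ≡ suc (toℕ j)
  j⁺≡ = toℕ-fromℕ< 1+j<k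

  c : Covers (NonAdj (coHalfGraph k)) (inj₁ j) (inj₁ j⁺) (inj₂ j)
  c .has = ≤⇒a≁b ≤-refl
  c .lacks a≁b = 1+n≰n (≤-trans (≤-reflexive (sym j⁺≡)) (a≁b⇒≤ a≁b))
  c .grow {inj₁ _} a~a = contradiction a~a a≁a
  c .grow {inj₂ i} a≁b = ≤⇒a≁b (≤-trans (<⇒≤ (≤-reflexive (sym j⁺≡))) (a≁b⇒≤ a≁b))
  c .drop {inj₁ _} _ a~a = contradiction a~a a≁a
  c .drop {inj₂ i} i≢j a≁b = ≤⇒a≁b (≤-trans (≤-reflexive j⁺≡)
    (≤∧≢⇒< (a≁b⇒≤ a≁b) (i≢j ∘ cong inj₂ ∘ sym ∘ toℕ-injective)))

completeGraph-≁ : ∀ {v w} → ¬ NonAdj (completeGraph m) v w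
completeGraph-≁ (v≢w , ¬v≢w) = ¬v≢w v≢w

coHalfUnion-isolated : ∀ ks .{{_ : NonZero m}} → ∃ λ o → ∀ w → ¬ NonAdj (coHalfUnion ks m) o w
coHalfUnion-isolated {suc m} [] = zero , λ w → completeGraph-≁
coHalfUnion-isolated (k ∷ ks) with o , iso ← coHalfUnion-isolated ks = inj₂ o , λ
  { (inj₁ _) (_ , ¬tt) → ¬tt tt
  ; (inj₂ w) o≁w → iso w (right⁻ (coHalfGraph k) (coHalfUnion ks _) o≁w) }

-- Covers stay within one part, except that a singleton neighbourhood goes down to an isolated
-- vertex of the tail.
coHalfUnion-covered : ∀ ks .{{_ : NonZero m}} → Covered (NonAdj (coHalfUnion ks m))
coHalfUnion-covered [] v≁x = contradiction v≁x completeGraph-≁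
coHalfUnion-covered (k ∷ ks) {inj₁ v} {inj₂ x} (_ , ¬tt) = contradiction tt ¬tt
coHalfUnion-covered (k ∷ ks) {inj₂ v} {inj₁ x} (_ , ¬tt) = contradiction tt ¬tt
coHalfUnion-covered {m} (k ∷ ks) {inj₁ v} {inj₁ x} v≁x
  with coHalfGraph-covers {v = v} (left⁻ (coHalfGraph k) (coHalfUnion ks m) v≁x)
... | p , inj₁ c with o , iso ← coHalfUnion-isolated {m} ks =
  inj₁ p , inj₂ o , union-covers-isolated (coHalfGraph k) (coHalfUnion ks m) c iso
... | p , inj₂ (q , c) = inj₁ p , inj₁ q , left-covers (coHalfGraph k) (coHalfUnion ks m) c
coHalfUnion-covered {m} (k ∷ ks) {inj₂ v} {inj₂ x} v≁x
  with p , q , c ← coHalfUnion-covered ks (right⁻ (coHalfGraph k) (coHalfUnion ks m) v≁x) =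
  inj₂ p , inj₂ q , right-covers (coHalfGraph k) (coHalfUnion ks m) c

module _ {G : Graph V} {H : Graph W} (iso : G ≅ H) where

  open _≅_ iso
  open Inverse bijection using (to; from; strictlyInverseˡ)
  open Injection (↔⇒↣ bijection) using (injective)

  ≅-nonAdj⁺ : ∀ {v w} → NonAdj G v w → NonAdj H (to v) (to w)
  ≅-nonAdj⁺ {v} {w} (v≢w , ¬vw) = v≢w ∘ injective , ¬vw ∘ Equivalence.from (preserves v w)

  ≅-nonAdj⁻ : ∀ {v w} → NonAdj H (to v) (to w) → NonAdj G v w
  ≅-nonAdj⁻ {v} {w} (v≢w , ¬vw) = v≢w ∘ cong to , ¬vw ∘ Equivalence.to (preserves v w)

  ≅-covered : Covered (NonAdj H) → Covered (NonAdj G)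
  ≅-covered covered {v} {x} v≁x with p′ , q′ , c ← covered (≅-nonAdj⁺ v≁x) =
    from p′ , from q′ , record
      { has = ≅-nonAdj⁻ (subst (λ p → NonAdj H p (to x)) (sym (strictlyInverseˡ p′)) (has c))
      ; lacks = λ q≁x → lacks c (subst (λ q → NonAdj H q (to x)) (strictlyInverseˡ q′) (≅-nonAdj⁺ q≁x))
      ; grow = λ {y} q≁y → ≅-nonAdj⁻ (subst (λ p → NonAdj H p (to y)) (sym (strictlyInverseˡ p′))
          (grow c (subst (λ q → NonAdj H q (to y)) (strictlyInverseˡ q′) (≅-nonAdj⁺ q≁y))))
      ; drop = λ {y} y≢x p≁y → ≅-nonAdj⁻ (subst (λ q → NonAdj H q (to y)) (sym (strictlyInverseˡ q′))
          (drop c (y≢x ∘ injective) (subst (λ p → NonAdj H p (to y)) (strictlyInverseˡ p′) (≅-nonAdj⁺ p≁y)))) }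

-- Subsets differing in one element, and symmetric differences.

lookup-ext : (∀ i → lookup P i ≡ lookup Q i) → P ≡ Q
lookup-ext {P = P} {Q} P≗Q =
  trans (sym (tabulate∘lookup P)) (trans (tabulate-cong P≗Q) (tabulate∘lookup Q))

lookup-⁅⁆ : (x y : Fin n) → lookup ⁅ x ⁆ y ≡ does (x ≟ y)
lookup-⁅⁆ x y with x ≟ y
... | yes refl = []=⇒lookup (x∈⁅x⁆ x)
... | no  x≢y with lookup ⁅ x ⁆ y in eq
...   | true  = contradiction (sym (x∈⁅y⁆⇒x≡y x (lookup⇒[]= y ⁅ x ⁆ eq))) x≢y
...   | false = refl

-- An arc labelled `x` with its direction forgotten.
record DifferOnlyAt (P Q : Subset n) (x : Fin n) : Set where
  constructor differ
  field
    at  : lookup P x ≢ lookup Q x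
    off : ∀ {y} → y ≢ x → lookup P y ≡ lookup Q y

open DifferOnlyAt

differ-sym : ∀ {x} → DifferOnlyAt P Q x → DifferOnlyAt Q P x
differ-sym d = differ (at d ∘ sym) (sym ∘ off d)

insert-differ : ∀ {x} → x Subset.∉ P → DifferOnlyAt P (P ∪ ⁅ x ⁆) x
insert-differ {P = P} {x} x∉P = differ
  (λ eq → contradiction (lookup⇒[]= x P (trans eq ([]=⇒lookup (q⊆p∪q P ⁅ x ⁆ (x∈⁅x⁆ x))))) x∉P)
  (λ {y} y≢x → sym (begin
    lookup (P ∪ ⁅ x ⁆) y          ≡⟨ lookup-zipWith _∨_ y P ⁅ x ⁆ ⟩
    lookup P y ∨ lookup ⁅ x ⁆ y   ≡⟨ cong (lookup P y ∨_) (trans (lookup-⁅⁆ x y) (dec-false (x ≟ y) (y≢x ∘ sym))) ⟩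
    lookup P y ∨ false            ≡⟨ Bool.∨-identityʳ _ ⟩
    lookup P y                    ∎))
  where open ≡-Reasoning

differ⇒insert : ∀ {x} → DifferOnlyAt P Q x → lookup P x ≡ false → Q ≡ P ∪ ⁅ x ⁆
differ⇒insert {P = P} {Q} {x} d Px = lookup-ext eq
  where
  inserted = insert-differ {P = P} (λ x∈P → contradiction (trans (sym ([]=⇒lookup x∈P)) Px) (λ ()))

  eq : ∀ y → lookup Q y ≡ lookup (P ∪ ⁅ x ⁆) y
  eq y with y ≟ x
  ... | no  y≢x  = trans (sym (off d y≢x)) (off inserted y≢x)
  -- Both entries are the negation of `lookup P x`.
  ... | yes refl = trans (Bool.¬-not (at d ∘ sym)) (sym (Bool.¬-not (at inserted ∘ sym)))

-- With only two truth values, `Q` agrees with `R` at `x`; everywhere else it agrees with `P`.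
△-shrink : ∀ {x} → DifferOnlyAt P Q x → lookup P x ≢ lookup R x → ∣ P △ R ∣ ≡ suc ∣ Q △ R ∣
△-shrink {P = p ∷ P} {q ∷ Q} {r ∷ R} {zero} d p≢r
  with refl ← lookup-ext {P = P} {Q} (λ i → off d {suc i} (λ ()))
  with p | q | r
... | true  | true  | _     = contradiction refl (at d)
... | false | false | _     = contradiction refl (at d)
... | true  | false | true  = contradiction refl p≢r
... | false | true  | false = contradiction refl p≢r
... | true  | false | false = refl
... | false | true  | true  = refl
△-shrink {P = p ∷ P} {q ∷ Q} {r ∷ R} {suc x} d P≢R
  with refl ← off d {zero} (λ ())
  with ih ← △-shrink {P = P} {Q} {R} (differ (at d) (λ {y} y≢x → off d {suc y} (λ { refl → y≢x refl }))) P≢R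
  with p | r
... | true  | true  = ih
... | true  | false = cong suc ih
... | false | true  = cong suc ih
... | false | false = ih

△-self : (P : Subset n) → ∣ P △ P ∣ ≡ 0
△-self []          = refl
△-self (true ∷ P)  = △-self P
△-self (false ∷ P) = △-self P

△-comm : (P Q : Subset n) → ∣ P △ Q ∣ ≡ ∣ Q △ P ∣
△-comm P Q = cong ∣_∣ (∪-comm (P Subset.─ Q) (Q Subset.─ P))

-- Walks in the one-inclusion graph, and shattering.

walk-snoc : {G : Graph V} → ∀ {u v w} → Walk G u v k → Adj G v w → Walk G u w (suc k)
walk-snoc nil         vw = cons vw nil
walk-snoc (cons uv p) vw = cons uv (walk-snoc p vw)

module _ (S : SetSystem n) where

  private
    O = oneInclusionGraph S
    set = ⟦_⟧ S

  adj⇒differ : ∀ {i j} → Adj O i j → ∃ (DifferOnlyAt (set i) (set j))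
  adj⇒differ (inj₁ (x , x∉i , j≡)) = x , subst (λ Q → DifferOnlyAt _ Q x) (sym j≡) (insert-differ x∉i)
  adj⇒differ (inj₂ (x , x∉j , i≡)) =
    x , differ-sym (subst (λ Q → DifferOnlyAt _ Q x) (sym i≡) (insert-differ x∉j))

  differ⇒adj : ∀ {i j x} → DifferOnlyAt (set i) (set j) x → Adj O i j
  differ⇒adj {i} {j} {x} d with lookup (set i) x in ix
  ... | false = inj₁ (x , (λ x∈i → contradiction (trans (sym ix) ([]=⇒lookup x∈i)) (λ ())) , differ⇒insert d ix)
  ... | true  = inj₂ (x , (λ x∈j → at d (trans ix (sym ([]=⇒lookup x∈j)))) ,
                      differ⇒insert (differ-sym d) (trans (Bool.¬-not (at d ∘ sym)) (cong not ix)))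

  -- An edge with another label preserves membership of `x`, so the disagreement passes on to the
  -- rest of the walk. This is how well-gradedness produces labels.
  walk-crosses : ∀ {i j x} → Walk O i j k → lookup (set i) x ≢ lookup (set j) x →
    ∃₂ λ i′ j′ → DifferOnlyAt (set i′) (set j′) x
  walk-crosses nil i≢i = contradiction refl i≢i
  walk-crosses {x = x} (cons im p) i≢j with y , d ← adj⇒differ im | x ≟ y
  ... | yes refl = _ , _ , d
  ... | no  x≢y  = walk-crosses p (i≢j ∘ trans (off d x≢y))

  -- One edge changes the symmetric difference with the endpoint by exactly one, in either
  -- direction.
  △≤walk : ∀ {i j} → Walk O i j k → ∣ set i △ set j ∣ ≤ k
  △≤walk {i = i} nil = ≤-reflexive (△-self (set i))
  △≤walk {i = i} {j} (cons {v = m} im p)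
    with y , d ← adj⇒differ im
    with lookup (set i) y Bool.≟ lookup (set j) y
  ... | no  i≢j = ≤-trans (≤-reflexive (△-shrink d i≢j)) (s≤s (△≤walk p))
  ... | yes i≡j = ≤-trans (n≤1+n _) (≤-trans
    (≤-reflexive (sym (△-shrink (differ-sym d) (λ m≡j → at d (trans i≡j (sym m≡j))))))
    (≤-trans (△≤walk p) (n≤1+n _)))

  -- Either set may be the one to move: for neighbourhoods, only the one with an additional element
  -- is moved, by losing a label.
  Approachable : Set
  Approachable = ∀ i j {x} → lookup (set i) x ≢ lookup (set j) x → ∃₂ λ m y →
    lookup (set i) y ≢ lookup (set j) y ×
    (DifferOnlyAt (set i) (set m) y ⊎ DifferOnlyAt (set j) (set m) y)

  -- Each move lowers the symmetric difference by one. A move of `i` extends the walk at its front,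
  -- a move of `j` at its end.
  geodesic : Approachable → ∀ i j → ∣ set i △ set j ∣ ≡ k → Walk O i j k
  geodesic {k} approach i j △≡k with any? (λ x → ¬? (lookup (set i) x Bool.≟ lookup (set j) x))
  ... | no same
    with refl ← lookup-injective (distinct S) (lookup-ext {P = set i} {set j}
      (λ x → decidable-stable (_ Bool.≟ _) (λ i≢j → same (x , i≢j))))
    with refl ← trans (sym △≡k) (△-self (set i)) = nil
  ... | yes (x , i≢j) with approach i j i≢j
  ...   | m , y , i≢j-y , inj₁ d with k | trans (sym △≡k) (△-shrink d i≢j-y)
  ...     | suc k | k≡ = cons (differ⇒adj d) (geodesic approach m j (sym (suc-injective k≡)))
  geodesic {k} approach i j △≡k | yes (x , i≢j) | m , y , i≢j-y , inj₂ d
    with k | trans (sym △≡k) (trans (△-comm (set i) (set j)) (△-shrink d (i≢j-y ∘ sym)))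
  ... | suc k | k≡ = walk-snoc
    (geodesic approach i m (sym (trans (suc-injective k≡) (△-comm (set m) (set i)))))
    (differ⇒adj (differ-sym d))

  approachable⇒wellGraded : Approachable → WellGraded S
  approachable⇒wellGraded approach i j = geodesic approach i j refl , λ _ → △≤walk

  -- Since `T` misses `Y`, the member `Z ∪ T` has trace `Z`. Extremality thus reduces to the
  -- converse implication.
  stronglyShattered⇒shattered : ∀ Y → StronglyShattered S Y → Shattered S Y
  stronglyShattered⇒shattered Y (T , T⊆∁Y , cube) Z = mk⇔ to from
    where
    to : Z ∈ trace S Y → Z ⊆ Y
    to Z∈ with A , _ , refl ← ∈-map⁻ (_∩ Y) (∈-deduplicate⁻ _≟ˢ_ (map (_∩ Y) (members S)) Z∈) = p∩q⊆q A Y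

    from : Z ⊆ Y → Z ∈ trace S Y
    from Z⊆Y = ∈-deduplicate⁺ _≟ˢ_ (subst (_∈ map (_∩ Y) (members S)) [Z∪T]∩Y≡Z
      (∈-map⁺ (_∩ Y) (cube Z Z⊆Y)))
      where
      [Z∪T]∩Y≡Z : (Z ∪ T) ∩ Y ≡ Z
      [Z∪T]∩Y≡Z = ⊆-antisym forth (λ x∈Z → x∈p∩q⁺ (p⊆p∪q T x∈Z , Z⊆Y x∈Z))
        where
        forth : (Z ∪ T) ∩ Y ⊆ Z
        forth x∈ with x∈Z∪T , x∈Y ← x∈p∩q⁻ (Z ∪ T) Y x∈ with x∈p∪q⁻ Z T x∈Z∪T
        ... | inj₁ x∈Z = x∈Z
        ... | inj₂ x∈T = contradiction x∈Y (x∈∁p⇒x∉p (T⊆∁Y x∈T))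

-- Systems indexed by vertices, and maximality.

unique-constant⇒length≡1 : {xs : List A} {x : A} → Unique xs → x ∈ xs →
  (∀ {y z} → y ∈ xs → z ∈ xs → y ≡ z) → length xs ≡ 1
unique-constant⇒length≡1 {xs = _ ∷ []} _ _ _ = refl
unique-constant⇒length≡1 {xs = y ∷ z ∷ _} ((y≢z ∷ _) ∷ _) _ constant =
  contradiction (constant (here refl) (there (here refl))) y≢z

length≡1⇒constant : {xs : List A} → length xs ≡ 1 → ∀ {x y} → x ∈ xs → y ∈ xs → x ≡ y
length≡1⇒constant {xs = _ ∷ []} refl (here refl) (here refl) = refl

module _ .{{_ : NonZero n}} (f : Fin n → Subset n) where

  private
    S = rangeSystem f

  Constant : Set
  Constant = ∀ u v → f u ≡ f v

  ∈-members⁺ : ∀ v → f v ∈ members S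
  ∈-members⁺ v = ∈-deduplicate⁺ _≟ˢ_ (∈-tabulate⁺ v)

  ∈-members⁻ : ∀ {A} → A ∈ members S → ∃ λ v → A ≡ f v
  ∈-members⁻ A∈ = ∈-tabulate⁻ (∈-deduplicate⁻ _≟ˢ_ (List.tabulate f) A∈)

  ∈-trace⁺ : ∀ Y v → (f v ∩ Y) ∈ trace S Y
  ∈-trace⁺ Y v = ∈-deduplicate⁺ _≟ˢ_ (∈-map⁺ (_∩ Y) (∈-members⁺ v))

  ∈-trace⁻ : ∀ {Y Z} → Z ∈ trace S Y → ∃ λ v → Z ≡ f v ∩ Y
  ∈-trace⁻ {Y} Z∈ with A , A∈ , refl ← ∈-map⁻ (_∩ Y) (∈-deduplicate⁻ _≟ˢ_ (map (_∩ Y) (members S)) Z∈)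
    with v , refl ← ∈-members⁻ A∈ = v , refl

  vertexOf : ∀ i → ∃ λ v → ⟦_⟧ S i ≡ f v
  vertexOf i = ∈-members⁻ (∈-lookup i)

  indexOf : ∀ v → ∃ λ i → ⟦_⟧ S i ≡ f v
  indexOf v = Any.index (∈-members⁺ v) , sym (lookup-index (∈-members⁺ v))

  length-trace≤n : ∀ Y → length (trace S Y) ≤ n
  length-trace≤n Y = begin
    length (trace S Y)                    ≤⟨ length-deduplicate _≟ˢ_ (map (_∩ Y) (members S)) ⟩
    length (map (_∩ Y) (members S))       ≡⟨ length-map (_∩ Y) (members S) ⟩
    length (members S)                    ≤⟨ length-deduplicate _≟ˢ_ (List.tabulate f) ⟩
    length (List.tabulate f)              ≡⟨ length-tabulate f ⟩
    n                                     ∎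
    where open ≤-Reasoning

  -- In dimension 0 the binomial sum for the whole set is 1, so there is a single member; a positive
  -- dimension fails by counting.
  maximum⇒constant : Maximum S → Constant
  maximum⇒constant (zero , _ , count) u v = begin
    f u       ≡⟨ ∩-identityʳ (f u) ⟨
    f u ∩ ⊤   ≡⟨ length≡1⇒constant (count ⊤) (∈-trace⁺ ⊤ u) (∈-trace⁺ ⊤ v) ⟩
    f v ∩ ⊤   ≡⟨ ∩-identityʳ (f v) ⟩
    f v       ∎
    where open ≡-Reasoning
  maximum⇒constant (suc d , _ , count) _ _ = contradiction 1+n≤n 1+n≰n
    where
    open ≤-Reasoning
    1+n≤n : suc n ≤ n
    1+n≤n = begin
      suc n                                   ≡⟨ cong suc (trans (nC1≡n _) (∣⊤∣≡n n)) ⟨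
      -- The first two terms of the binomial sum, the one for 0 evaluating to 1.
      suc (∣ ⊤ {n} ∣ C 1)                     ≤⟨ s≤s (m≤m+n _ _) ⟩
      _                                       ≡⟨ count ⊤ ⟨
      length (trace S ⊤)                      ≤⟨ length-trace≤n ⊤ ⟩
      n                                       ∎

  constant⇒maximum : Fin n → Constant → Maximum S
  constant⇒maximum v₀ constant =
    0 , ((⊥ , stronglyShattered⇒shattered S ⊥ empty-strong , ∣⊥∣≡0 n) , only-empty) , count
    where
    trace-constant : ∀ Y {Z W} → Z ∈ trace S Y → W ∈ trace S Y → Z ≡ W
    trace-constant Y Z∈ W∈ with u , refl ← ∈-trace⁻ Z∈ with v , refl ← ∈-trace⁻ W∈ =
      cong (_∩ Y) (constant u v)

    empty-strong : StronglyShattered S ⊥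
    empty-strong = f v₀ , (λ x∈ → x∉p⇒x∈∁p ∉⊥) , λ Z Z⊆⊥ →
      subst (_∈ members S) (sym (trans (cong (_∪ f v₀) (⊆-antisym Z⊆⊥ ⊥⊆)) (∪-identityˡ (f v₀)))) (∈-members⁺ v₀)

    only-empty : ∀ Y → Shattered S Y → ∣ Y ∣ ≤ 0
    only-empty Y shattered = ≤-reflexive (trans (cong ∣_∣ Y≡⊥) (∣⊥∣≡0 n))
      where
      Y≡⊥ : Y ≡ ⊥
      -- A shattered `Y` has both `Y` and `⊥` as traces.
      Y≡⊥ = trace-constant Y (Equivalence.from (shattered Y) id) (Equivalence.from (shattered ⊥) ⊥⊆)

    count : ∀ Y → length (trace S Y) ≡ 1
    count Y = unique-constant⇒length≡1 (deduplicate-! _≟ˢ_ (map (_∩ Y) (members S)))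
      (∈-trace⁺ Y v₀) (trace-constant Y)

-- Well-gradedness of both neighbourhood systems.

-- Satisfied by both f v = N_H(v), with σ = id, and f v = V ∖ N_H(v), with σ = not.
record Represents (H : Graph (Fin n)) (f : Fin n → Subset n) : Set where
  field
    σ        : Bool → Bool
    σ-inj    : ∀ {a b} → σ a ≡ σ b → a ≡ b
    f-lookup : ∀ v x → lookup (f v) x ≡ σ (does (adj? H v x))

nbhd-represents : (H : Graph (Fin n)) → Represents H (N H)
nbhd-represents H = record { σ = id ; σ-inj = id ; f-lookup = λ v x → lookup∘tabulate (does ∘ adj? H v) x }

closedNbhd-represents : (G : Graph (Fin n)) → Represents (complement G) N[ G ]
closedNbhd-represents G = record { σ = not ; σ-inj = Bool.not-injective ; f-lookup = f-lookup }
  where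
  open ≡-Reasoning
  -- De Morgan, with the right-hand side in the form to which the decision of adjacency in the
  -- complement evaluates.
  not-nor : ∀ a b → a ∨ b ≡ not (not b ∧ not a)
  not-nor true  true  = refl
  not-nor true  false = refl
  not-nor false true  = refl
  not-nor false false = refl

  f-lookup : ∀ v x → lookup (N[ G ] v) x ≡ not (does (adj? (complement G) v x))
  f-lookup v x = begin
    lookup (N G v ∪ ⁅ v ⁆) x                    ≡⟨ lookup-zipWith _∨_ x (N G v) ⁅ v ⁆ ⟩
    lookup (N G v) x ∨ lookup ⁅ v ⁆ x           ≡⟨ cong₂ _∨_ (lookup∘tabulate (does ∘ adj? G v) x) (lookup-⁅⁆ v x) ⟩
    does (adj? G v x) ∨ does (v ≟ x)            ≡⟨ not-nor (does (adj? G v x)) (does (v ≟ x)) ⟩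
    not (does (adj? (complement G) v x))        ∎

module RepresentedSystem .{{_ : NonZero n}} {H : Graph (Fin n)} (irrefl : Loopless H)
                         {f : Fin n → Subset n} (represents : Represents H f) where

  open Represents represents

  private
    S = rangeSystem f
    _~_ = Adj H

  row : Fin n → Fin n → Bool
  row v x = does (adj? H v x)

  lookup≡⇒row≡ : ∀ {u v x} → lookup (f u) x ≡ lookup (f v) x → row u x ≡ row v x
  lookup≡⇒row≡ {u} {v} {x} eq = σ-inj (trans (sym (f-lookup u x)) (trans eq (f-lookup v x)))

  row≡⇒lookup≡ : ∀ {u v x} → row u x ≡ row v x → lookup (f u) x ≡ lookup (f v) x
  row≡⇒lookup≡ {u} {v} {x} eq = trans (f-lookup u x) (trans (cong σ eq) (sym (f-lookup v x)))

  row-~ : ∀ {u v x} → row u x ≡ row v x → u ~ x → v ~ x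
  row-~ {u} {v} {x} eq u~x with adj? H v x
  ... | yes v~x = v~x
  ... | no  _   = contradiction (trans (sym (dec-true (adj? H u x) u~x)) eq) (λ ())

  ~-row : ∀ {u v x} → (u ~ x → v ~ x) → (v ~ x → u ~ x) → row u x ≡ row v x
  ~-row {u} {v} {x} to from with adj? H u x | adj? H v x
  ... | yes _   | yes _   = refl
  ... | no _    | no _    = refl
  ... | yes u~x | no v≁x  = contradiction (to u~x) v≁x
  ... | no u≁x  | yes v~x = contradiction (from v~x) u≁x

  differ⇒covers : ∀ {u v x} → DifferOnlyAt (f u) (f v) x → ¬ v ~ x → Covers _~_ u v x
  differ⇒covers {u} {v} {x} d v≁x = record
    { has   = decidable-stable (adj? H u x) (λ u≁x → at d (row≡⇒lookup≡
        (~-row (λ u~x → contradiction u~x u≁x) (λ v~x → contradiction v~x v≁x))))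
    ; lacks = v≁x
    ; grow  = λ {y} v~y → row-~ (sym (lookup≡⇒row≡ (off d (λ { refl → v≁x v~y })))) v~y
    ; drop  = λ y≢x → row-~ (lookup≡⇒row≡ (off d y≢x)) }

  covers⇒differ : ∀ {u v x} → Covers _~_ u v x → DifferOnlyAt (f u) (f v) x
  covers⇒differ c = differ
    (λ eq → lacks c (row-~ (lookup≡⇒row≡ eq) (has c)))
    (λ y≢x → row≡⇒lookup≡ (~-row (drop c y≢x) (grow c)))

  -- The neighbourhoods of `v` and `x` disagree at `x`, as `x` is no neighbour of itself. A walk
  -- between them uses an edge labelled `x`, whose end without the neighbour `x` is the lower one.
  wellGraded⇒covered : WellGraded S → Covered _~_
  wellGraded⇒covered wg {v} {x} v~x
    with i , i≡ ← indexOf f v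
    with j , j≡ ← indexOf f x
    with i′ , j′ , d ← walk-crosses S {x = x} (proj₁ (wg i j)) (λ eq → irrefl x
      (row-~ (lookup≡⇒row≡ (subst₂ (λ A B → lookup A x ≡ lookup B x) i≡ j≡ eq)) v~x))
    with p , p≡ ← vertexOf f i′
    with q , q≡ ← vertexOf f j′
    with d′ ← subst₂ (λ A B → DifferOnlyAt A B x) p≡ q≡ d
    with adj? H q x
  ... | no  q≁x = p , q , differ⇒covers d′ q≁x
  ... | yes q~x = q , p , differ⇒covers (differ-sym d′)
    (λ p~x → at d′ (row≡⇒lookup≡ (~-row (λ _ → q~x) (λ _ → p~x))))

  covered⇒wellGraded : Covered _~_ → WellGraded S
  covered⇒wellGraded covered = approachable⇒wellGraded S approach
    where
    open NeighbourhoodChains H irrefl covered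

    -- The lost label `w` separates `u` from `v`: if `v ~ w` held, N(v) would contain N(u) by
    -- `least-above-label`, and with it `x`.
    descend : ∀ {u v x} → u ~ x → ¬ v ~ x → ∃₂ λ q w → Covers _~_ u q w × ¬ v ~ w
    descend {v = v} u~x v≁x with q , w , c ← predecessor u~x =
      q , w , c , λ v~w → v≁x (least-above-label c v v~w u~x)

    step : ∀ {u v x} → u ~ x → ¬ v ~ x → ∃₂ λ m y →
      lookup (f u) y ≢ lookup (f v) y × DifferOnlyAt (f u) (⟦_⟧ S m) y
    step u~x v≁x
      with q , w , c , v≁w ← descend u~x v≁x
      with m , m≡ ← indexOf f q =
      m , w , (λ eq → v≁w (row-~ (lookup≡⇒row≡ eq) (has c))) ,
      subst (λ B → DifferOnlyAt _ B w) (sym m≡) (covers⇒differ c)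

    approach : Approachable S
    approach i j {x} i≢j
      with u , i≡ ← vertexOf f i
      with v , j≡ ← vertexOf f j
      rewrite i≡ | j≡
      with adj? H u x | adj? H v x
    ... | yes u~x | no v≁x with m , y , u≢v , d ← step u~x v≁x = m , y , u≢v , inj₁ d
    ... | no u≁x | yes v~x with m , y , v≢u , d ← step v~x u≁x = m , y , v≢u ∘ sym , inj₂ d
    ... | yes u~x | yes v~x = contradiction (row≡⇒lookup≡ (~-row (λ _ → v~x) (λ _ → u~x))) i≢j
    ... | no u≁x | no v≁x = contradiction
      (row≡⇒lookup≡ (~-row (λ u~x → contradiction u~x u≁x) (λ v~x → contradiction v~x v≁x))) i≢j

  constant⇒edgeless : Constant f → ∀ {v x} → ¬ v ~ x
  constant⇒edgeless constant {v} {x} v~x =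
    irrefl x (row-~ (lookup≡⇒row≡ (cong (λ A → lookup A x) (constant v x))) v~x)

  edgeless⇒constant : (∀ {v x} → ¬ v ~ x) → Constant f
  edgeless⇒constant edgeless u v = lookup-ext
    (λ x → row≡⇒lookup≡ (~-row (λ u~x → contradiction u~x edgeless) (λ v~x → contradiction v~x edgeless)))

  maximum⇒edgeless : Maximum S → ∀ {v x} → ¬ v ~ x
  maximum⇒edgeless max = constant⇒edgeless (maximum⇒constant f max)

  edgeless⇒maximum : (∀ {v x} → ¬ v ~ x) → Maximum S
  edgeless⇒maximum edgeless = constant⇒maximum f (vertex n) (edgeless⇒constant edgeless)

-- Extremality of the closed-neighbourhood system.

module ClosedSystem .{{_ : NonZero n}} (G : Graph (Fin n)) where

  private
    S = closedNbhdSystem G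
    H = complement G
    _~_ = Adj H

  open Represents (closedNbhd-represents G)

  ∈⇒≁ : ∀ {v x} → x Subset.∈ N[ G ] v → ¬ v ~ x
  ∈⇒≁ {v} {x} x∈ v~x = contradiction
    (trans (sym ([]=⇒lookup x∈)) (trans (f-lookup v x) (cong not (dec-true (adj? H v x) v~x)))) (λ ())

  ≁⇒∈ : ∀ {v x} → ¬ v ~ x → x Subset.∈ N[ G ] v
  ≁⇒∈ {v} {x} v≁x = lookup⇒[]= x _ (trans (f-lookup v x) (cong not (dec-false (adj? H v x) v≁x)))

  ∉⇒~ : ∀ {v x} → x Subset.∉ N[ G ] v → v ~ x
  ∉⇒~ {v} {x} x∉ = decidable-stable (adj? H v x) (x∉ ∘ ≁⇒∈)

  ∈⊥∪⇒∈ : ∀ {T : Subset n} {y} → y Subset.∈ ⊥ ∪ T → y Subset.∈ T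
  ∈⊥∪⇒∈ {T} = subst (_ Subset.∈_) (∪-identityˡ T)

  -- The closed neighbourhood of `x` contains `x`, and that of `v` does not.
  ~⇒shattered : ∀ {v x} → v ~ x → Shattered S ⁅ x ⁆
  ~⇒shattered {v} {x} v~x Z = mk⇔ to from
    where
    to : Z ∈ trace S ⁅ x ⁆ → Z ⊆ ⁅ x ⁆
    to Z∈ with u , refl ← ∈-trace⁻ N[ G ] Z∈ = p∩q⊆q (N[ G ] u) ⁅ x ⁆

    from : Z ⊆ ⁅ x ⁆ → Z ∈ trace S ⁅ x ⁆
    from Z⊆x with x ∈? Z
    ... | yes x∈Z = subst (_∈ trace S ⁅ x ⁆)
      (⊆-antisym (λ y∈ → subst (Subset._∈ Z) (sym (x∈⁅y⁆⇒x≡y x (p∩q⊆q _ _ y∈))) x∈Z)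
                 (λ y∈Z → x∈p∩q⁺ (subst (Subset._∈ N[ G ] x) (sym (x∈⁅y⁆⇒x≡y x (Z⊆x y∈Z)))
                   (≁⇒∈ (complement-irrefl G x)) , Z⊆x y∈Z)))
      (∈-trace⁺ N[ G ] ⁅ x ⁆ x)
    ... | no  x∉Z = subst (_∈ trace S ⁅ x ⁆)
      (⊆-antisym (λ y∈ → contradiction v~x (∈⇒≁ (subst (Subset._∈ N[ G ] v)
                   (x∈⁅y⁆⇒x≡y x (p∩q⊆q _ _ y∈)) (p∩q⊆p _ _ y∈))))
                 (λ y∈Z → contradiction (subst (Subset._∈ Z) (x∈⁅y⁆⇒x≡y x (Z⊆x y∈Z)) y∈Z) x∉Z))
      (∈-trace⁺ N[ G ] ⁅ x ⁆ v)

  -- The singleton of `x` is shattered, hence strongly shattered, so `T` and `T` with `x` added are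
  -- the closed neighbourhoods of some `p` and `q`. Taking complements reverses the inclusion, which
  -- makes `p` the upper end of the cover.
  extremal⇒covered : Extremal S → Covered _~_
  extremal⇒covered extremal {v} {x} v~x
    with T , T⊆∁x , cube ← Equivalence.to (extremal ⁅ x ⁆) (~⇒shattered v~x)
    with p , p≡ ← ∈-members⁻ N[ G ] (cube ⊥ ⊥⊆)
    with q , q≡ ← ∈-members⁻ N[ G ] (cube ⁅ x ⁆ id) = p , q , record
      { has   = ∉⇒~ (λ x∈p → contradiction (x∈⁅x⁆ x)
          (x∈∁p⇒x∉p (T⊆∁x (∈⊥∪⇒∈ (subst (x Subset.∈_) (sym p≡) x∈p)))))
      ; lacks = ∈⇒≁ (subst (x Subset.∈_) q≡ (p⊆p∪q T (x∈⁅x⁆ x)))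
      ; grow  = λ {y} q~y → ∉⇒~ (λ y∈p →
          ∈⇒≁ (subst (y Subset.∈_) q≡ (q⊆p∪q ⁅ x ⁆ T (∈⊥∪⇒∈ (subst (y Subset.∈_) (sym p≡) y∈p)))) q~y)
      ; drop  = λ {y} y≢x p~y → ∉⇒~ (λ y∈q →
          [ (λ y∈x → y≢x (x∈⁅y⁆⇒x≡y x y∈x))
          , (λ y∈T → ∈⇒≁ (subst (y Subset.∈_) p≡ (q⊆p∪q ⊥ T y∈T)) p~y)
          ]′ (x∈p∪q⁻ ⁅ x ⁆ T (subst (y Subset.∈_) (sym q≡) y∈q))) }

  shattered-pattern : ∀ {Y Z} → Shattered S Y → Z ⊆ Y →
    ∃ λ v → ∀ {x} → x Subset.∈ Y → (x Subset.∈ Z → ¬ v ~ x) × (x Subset.∉ Z → v ~ x)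
  shattered-pattern {Y} {Z} shattered Z⊆Y
    with v , refl ← ∈-trace⁻ N[ G ] (Equivalence.from (shattered Z) Z⊆Y) =
    v , λ x∈Y → (λ x∈Z → ∈⇒≁ (p∩q⊆p _ _ x∈Z)) , (λ x∉Z → ∉⇒~ (λ x∈N → x∉Z (x∈p∩q⁺ (x∈N , x∈Y))))

  covered⇒extremal : Covered _~_ → Extremal S
  covered⇒extremal covered Y = mk⇔ strong (stronglyShattered⇒shattered S Y)
    where
    open NeighbourhoodChains H (complement-irrefl G) covered

    ⁅⁆⊆ : ∀ {x} → x Subset.∈ Y → ⁅ x ⁆ ⊆ Y
    ⁅⁆⊆ {x} x∈Y y∈x = subst (Subset._∈ Y) (sym (x∈⁅y⁆⇒x≡y x y∈x)) x∈Y

    -- Three of the four patterns on {x, y} already contradict comparability of N(x) and N(y).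
    subsingleton : Shattered S Y → ∀ {x y} → x Subset.∈ Y → y Subset.∈ Y → y ≡ x
    subsingleton shattered {x} {y} x∈Y y∈Y with y ≟ x
    ... | yes y≡x = y≡x
    ... | no  y≢x
      with u , only-x ← shattered-pattern shattered (⁅⁆⊆ x∈Y)
      with v , only-y ← shattered-pattern shattered (⁅⁆⊆ y∈Y)
      with w , none ← shattered-pattern {Z = ⊥} shattered ⊥⊆
      with comparable w (proj₂ (none x∈Y) ∉⊥) (proj₂ (none y∈Y) ∉⊥)
    ... | inj₁ Nx⊆Ny = contradiction
      (adj-sym H (Nx⊆Ny (adj-sym H (proj₂ (only-y x∈Y) (x≢y⇒x∉⁅y⁆ (y≢x ∘ sym))))))
      (proj₁ (only-y y∈Y) (x∈⁅x⁆ y))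
    ... | inj₂ Ny⊆Nx = contradiction
      (adj-sym H (Ny⊆Nx (adj-sym H (proj₂ (only-x y∈Y) (x≢y⇒x∉⁅y⁆ y≢x)))))
      (proj₁ (only-x x∈Y) (x∈⁅x⁆ x))

    -- A shattered set is empty, where any member serves as `T`, or a single `x`. In the second case
    -- the pattern `⊥` shows `x` to be non-isolated, and a cover with label `x` supplies the two
    -- members N[p] and N[q], the latter being N[p] with `x` added.
    strong : Shattered S Y → StronglyShattered S Y
    strong shattered with nonempty? Y
    ... | no empty = N[ G ] (vertex n) , (λ _ → x∉p⇒x∈∁p (λ x∈Y → empty (_ , x∈Y))) , λ Z Z⊆Y →
      subst (_∈ members S)
        (sym (trans (cong (_∪ N[ G ] (vertex n))
          (Empty-unique (λ (x , x∈Z) → empty (x , Z⊆Y x∈Z)))) (∪-identityˡ _)))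
        (∈-members⁺ N[ G ] (vertex n))
    ... | yes (x , x∈Y)
      with v , none ← shattered-pattern {Z = ⊥} shattered ⊥⊆
      with p , q , c ← covered (proj₂ (none x∈Y) ∉⊥) = N[ G ] p , T⊆∁Y , cube
      where
      T⊆∁Y : N[ G ] p ⊆ ∁ Y
      T⊆∁Y y∈p = x∉p⇒x∈∁p (λ y∈Y →
        ∈⇒≁ (subst (Subset._∈ N[ G ] p) (subsingleton shattered x∈Y y∈Y) y∈p) (has c))

      cube : ∀ Z → Z ⊆ Y → (Z ∪ N[ G ] p) ∈ members S
      cube Z Z⊆Y with x ∈? Z
      ... | no x∉Z = subst (_∈ members S)
        (sym (trans (cong (_∪ N[ G ] p) (Empty-unique (λ (y , y∈Z) →
          x∉Z (subst (Subset._∈ Z) (subsingleton shattered x∈Y (Z⊆Y y∈Z)) y∈Z)))) (∪-identityˡ _)))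
        (∈-members⁺ N[ G ] p)
      ... | yes x∈Z = subst (_∈ members S) (⊆-antisym Nq⊆ ⊆Nq) (∈-members⁺ N[ G ] q)
        where
        Nq⊆ : N[ G ] q ⊆ Z ∪ N[ G ] p
        Nq⊆ {y} y∈q with y ≟ x
        ... | yes refl = p⊆p∪q _ x∈Z
        ... | no y≢x = q⊆p∪q Z _ (≁⇒∈ (∈⇒≁ y∈q ∘ drop c y≢x))

        ⊆Nq : Z ∪ N[ G ] p ⊆ N[ G ] q
        ⊆Nq y∈ with x∈p∪q⁻ Z (N[ G ] p) y∈
        ... | inj₁ y∈Z = ≁⇒∈ (subst (λ y → ¬ q ~ y) (sym (subsingleton shattered x∈Y (Z⊆Y y∈Z))) (lacks c))
        ... | inj₂ y∈p = ≁⇒∈ (∈⇒≁ y∈p ∘ grow c)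

-- Complete graphs and the assembly of the equivalences.

complete⇒edgeless : (G : Graph (Fin n)) → IsComplete G → ∀ {v x} → ¬ Adj (complement G) v x
complete⇒edgeless G (m , _ , iso) = completeGraph-≁ ∘ ≅-nonAdj⁺ iso

edgeless⇒complete : .{{_ : NonZero n}} (G : Graph (Fin n)) → Loopless G →
  (∀ {v x} → ¬ Adj (complement G) v x) → IsComplete G
edgeless⇒complete {n} G loopless edgeless = n , Fin⇒nonZero (vertex n) , record
  { bijection = ↔-id (Fin n)
  ; preserves = λ v w → mk⇔ (λ vw v≡w → loopless w (subst (λ v → Adj G v w) v≡w vw))
      (λ v≢w → decidable-stable (adj? G v w) (λ ¬vw → edgeless (v≢w , ¬vw))) }

union⇒covered : (G : Graph (Fin n)) → IsComplete G ⊎ IsUnionOfCoHalfGraphsAndComplete G →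
  Covered (Adj (complement G))
union⇒covered G (inj₁ complete) v~x = contradiction v~x (complete⇒edgeless G complete)
union⇒covered G (inj₂ (ks , m , _ , _ , m≢0 , iso)) = ≅-covered iso (coHalfUnion-covered ks {{m≢0}})

theorem5p12 : ∀ (n : ℕ) .{{_ : NonZero n}} (G : Graph (Fin n)) → Loopless G →
    ((WellGraded (closedNbhdSystem G) ⇔ Extremal (closedNbhdSystem G))
    × (Extremal (closedNbhdSystem G) ⇔ (IsComplete G ⊎ IsUnionOfCoHalfGraphsAndComplete G))
    × ((IsComplete G ⊎ IsUnionOfCoHalfGraphsAndComplete G) ⇔ WellGraded (nbhdSystem (complement G))))
    × ((Maximum (closedNbhdSystem G) ⇔ Maximum (nbhdSystem (complement G)))
    × (Maximum (nbhdSystem (complement G)) ⇔ IsComplete G))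
theorem5p12 n G loopless =
  ( mk⇔ (covered⇒extremal ∘ Closed.wellGraded⇒covered) (Closed.covered⇒wellGraded ∘ extremal⇒covered)
  , mk⇔ (classify ∘ extremal⇒covered) (covered⇒extremal ∘ union⇒covered G)
  , mk⇔ (Open.covered⇒wellGraded ∘ union⇒covered G) (classify ∘ Open.wellGraded⇒covered))
  , mk⇔ (λ max → Open.edgeless⇒maximum (Closed.maximum⇒edgeless max))
        (λ max → Closed.edgeless⇒maximum (Open.maximum⇒edgeless max))
  , mk⇔ (λ max → edgeless⇒complete G loopless (Open.maximum⇒edgeless max))
        (λ complete → Open.edgeless⇒maximum (complete⇒edgeless G complete))
  where
  module Closed = RepresentedSystem (complement-irrefl G) (closedNbhd-represents G)
  module Open = RepresentedSystem (complement-irrefl G) (nbhd-represents (complement G))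
  open ClosedSystem G

  classify : Covered (Adj (complement G)) → IsComplete G ⊎ IsUnionOfCoHalfGraphsAndComplete G
  classify covered = Decomposition.classification G loopless covered (vertex n)
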